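{- Computability is stable over the structures $\langle\mathbb{N},S\rangle$ and $\langle\mathbb{N},+\rangle$, where $S$ is the successor function and $+$ is addition of natural numbers.
   Context: Computability over natural numbers is the usual one. A set $A \subseteq \mathbb{N}$ is effectively enumerable if it is empty or the image of a total computable function from $\mathbb{N}$ to $\mathbb{N}$. For $A \subseteq \mathbb{N}^m$ and $B \subseteq \mathbb{N}$, a computable function from $A$ to $B$ is a partial computable function that is defined at every element of $A$ and takes values in $B$ there. Indexing: an indexing of a set $E$ is a partial function $i$ from $\mathbb{N}$ to $E$ such that $dom(i)$ is effectively enumerable, $i$ is surjective, and there is a computable function $eq$ from $dom(i)\times dom(i)$ to $\{0,1\}$ with $eq(x,y)=1$ if $i(x)=i(y)$ and $eq(x,y)=0$ otherwise. An indexing $i$ of the set $E$ is an admissible indexing of a one-sorted structure $\langle E,op_1,\ldots,op_p\rangle$ if every operation $op: E^m\to E$ among $op_1,\ldots,op_p$ is computable relatively to $i$, that is, there is a computable function $\hat{op}$ from $dom(i)^m$ to $dom(i)$ such that $i(\hat{op}(x_1,\ldots,x_m)) = op(i(x_1),\ldots,i(x_m))$ for all $x_1,\ldots,x_m\in dom(i)$. Computability is stable over $\langle E,op_1,\ldots,op_p\rangle$ if there exists an admissible indexing of this structure and, for all admissible indexings $j$ and $j'$ of it, there exists a computable function $h$ from $dom(j')$ to $dom(j)$ such that $j' = j\circ h$. -}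

module Defs where

open import Data.Fin.Base using (Fin)
open import Data.List.Base using (List; [_])
open import Data.List.Membership.Propositional using (_∈_)
open import Data.Nat.Base using (ℕ; suc; _+_; _<_)
open import Data.Nat.Properties using (<-cmp)
open import Data.Product.Base using (Σ; ∃; ∃-syntax; _×_; _,_)
open import Data.Sum.Base using (_⊎_)
open import Data.Vec.Base using (Vec; []; _∷_; lookup)
open import Data.Vec.Relation.Unary.All using (All)
open import Data.Vec.Relation.Binary.Pointwise.Inductive using (Pointwise; []; _∷_)
open import Function.Bundles using (_⇔_)
open import Level using (0ℓ)
open import Relation.Binary.Definitions using (tri<; tri≈; tri>)
open import Relation.Binary.PropositionalEquality using (_≡_; _≢_; refl)
open import Relation.Nullary.Negation using (contradiction)
open import Relation.Unary using (Pred; U; Empty)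

infix 4 _⇀_ _≗ₚ_
infixr 9 _∘ₚ_

record _⇀_ (X Y : Set) : Set₁ where
  field
    _↦_        : X → Y → Set
    functional : ∀ {x y y′} → x ↦ y → x ↦ y′ → y ≡ y′

  dom : Pred X 0ℓ
  dom x = ∃ (x ↦_)

  image : Pred Y 0ℓ
  image y = ∃ (_↦ y)

open _⇀_ public using (dom; image)

_≗ₚ_ : ∀ {X Y} → X ⇀ Y → X ⇀ Y → Set
f ≗ₚ g = ∀ x y → (x f.↦ y) ⇔ (x g.↦ y)
  where module f = _⇀_ f
        module g = _⇀_ g

_∘ₚ_ : ∀ {X Y Z} → Y ⇀ Z → X ⇀ Y → X ⇀ Z
g ∘ₚ f = record
  { _↦_        = λ x z → ∃[ y ] (x f.↦ y) × (y g.↦ z)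
  ; functional = λ { (_ , p , q) (_ , p′ , q′) → single p q p′ q′ }
  }
  where
  module f = _⇀_ f
  module g = _⇀_ g
  single : ∀ {x y y′ z z′} → x f.↦ y → y g.↦ z → x f.↦ y′ → y′ g.↦ z′ → z ≡ z′
  single p q p′ q′ with refl ← f.functional p p′ = g.functional q q′

-- Codes for the partial recursive functions; rec recurses on the first
-- argument and mu minimises over it.
data PR : ℕ → Set where
  zer  : ∀ {n} → PR n
  suc  : PR 1
  proj : ∀ {n} → Fin n → PR n
  comp : ∀ {m n} → PR m → Vec (PR n) m → PR n
  rec  : ∀ {n} → PR n → PR (suc (suc n)) → PR (suc n)
  mu   : ∀ {n} → PR (suc n) → PR n

infix 4 _⟨_⟩⇓_

data _⟨_⟩⇓_ : ∀ {n} → PR n → Vec ℕ n → ℕ → Set where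
  zer⇓   : ∀ {n} {xs : Vec ℕ n} → zer ⟨ xs ⟩⇓ 0
  suc⇓   : ∀ {x} → suc ⟨ x ∷ [] ⟩⇓ suc x
  proj⇓  : ∀ {n} {k : Fin n} {xs} → proj k ⟨ xs ⟩⇓ lookup xs k
  comp⇓  : ∀ {m n} {f : PR m} {gs : Vec (PR n) m} {xs ys z} →
           Pointwise (λ g y → g ⟨ xs ⟩⇓ y) gs ys → f ⟨ ys ⟩⇓ z →
           comp f gs ⟨ xs ⟩⇓ z
  rec⇓-z : ∀ {n} {f : PR n} {g xs y} →
           f ⟨ xs ⟩⇓ y → rec f g ⟨ 0 ∷ xs ⟩⇓ y
  rec⇓-s : ∀ {n} {f : PR n} {g x xs r y} →
           rec f g ⟨ x ∷ xs ⟩⇓ r → g ⟨ x ∷ r ∷ xs ⟩⇓ y →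
           rec f g ⟨ suc x ∷ xs ⟩⇓ y
  -- f must be defined (and nonzero) at every smaller argument.
  mu⇓    : ∀ {n} {f : PR (suc n)} {xs y} →
           f ⟨ y ∷ xs ⟩⇓ 0 →
           (∀ z → z < y → ∃[ v ] f ⟨ z ∷ xs ⟩⇓ suc v) →
           mu f ⟨ xs ⟩⇓ y

⇓-functional : ∀ {n} {c : PR n} {xs y y′} → c ⟨ xs ⟩⇓ y → c ⟨ xs ⟩⇓ y′ → y ≡ y′
⇓-functional* : ∀ {m n} {gs : Vec (PR n) m} {xs ys ys′} →
  Pointwise (λ g y → g ⟨ xs ⟩⇓ y) gs ys → Pointwise (λ g y → g ⟨ xs ⟩⇓ y) gs ys′ → ys ≡ ys′

⇓-functional zer⇓ zer⇓ = refl
⇓-functional suc⇓ suc⇓ = refl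
⇓-functional proj⇓ proj⇓ = refl
⇓-functional (comp⇓ ps q) (comp⇓ ps′ q′) with refl ← ⇓-functional* ps ps′ = ⇓-functional q q′
⇓-functional (rec⇓-z p) (rec⇓-z p′) = ⇓-functional p p′
⇓-functional (rec⇓-s p q) (rec⇓-s p′ q′) with refl ← ⇓-functional p p′ = ⇓-functional q q′
⇓-functional (mu⇓ {y = y} p below) (mu⇓ {y = y′} p′ below′) with <-cmp y y′
... | tri≈ _ y≡y′ _ = y≡y′
... | tri< y<y′ _ _ with (_ , q) ← below′ y y<y′ = contradiction (⇓-functional p q) λ ()
... | tri> _ _ y′<y with (_ , q) ← below y′ y′<y = contradiction (⇓-functional q p′) λ ()

⇓-functional* [] [] = refl
⇓-functional* (p ∷ ps) (p′ ∷ ps′)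
  with refl ← ⇓-functional p p′ | refl ← ⇓-functional* ps ps′ = refl

⟦_⟧ : ∀ {n} → PR n → Vec ℕ n ⇀ ℕ
⟦ c ⟧ = record { _↦_ = c ⟨_⟩⇓_ ; functional = ⇓-functional }

infix 8 _^_

_^_ : ∀ {X : Set} → Pred X 0ℓ → (m : ℕ) → Pred (Vec X m) 0ℓ
A ^ m = All A {m}

-- Computable functions from A ⊆ ℕᵐ to B ⊆ ℕ.  Nothing is required of the
-- underlying partial computable function outside A.
record ComputableFun {m : ℕ} (A : Pred (Vec ℕ m) 0ℓ) (B : Pred ℕ 0ℓ) : Set where
  field
    code : PR m
    maps : ∀ {xs} → A xs → ∃[ y ] B y × code ⟨ xs ⟩⇓ y

  partialFun : Vec ℕ m ⇀ ℕ
  partialFun = ⟦ code ⟧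

  open _⇀_ partialFun public using (_↦_)

open ComputableFun public using (partialFun)

unary : ∀ {X Y} → Vec X 1 ⇀ Y → X ⇀ Y
unary f = record { _↦_ = λ x y → (x ∷ []) f.↦ y ; functional = f.functional }
  where module f = _⇀_ f

EffectivelyEnumerable : Pred ℕ 0ℓ → Set
EffectivelyEnumerable A =
  Empty A ⊎ Σ (ComputableFun (U ^ 1) U) λ f → ∀ x → A x ⇔ image (unary (partialFun f)) x

record IsIndexing {E : Set} (i : ℕ ⇀ E) : Set where
  open _⇀_ i using (_↦_)
  field
    dom-enumerable : EffectivelyEnumerable (dom i)
    surjective     : ∀ e → image i e
    eq             : ComputableFun (dom i ^ 2) (λ v → v ≡ 0 ⊎ v ≡ 1)

  module eq = ComputableFun eq

  field
    eq-≡ : ∀ {x y a b} → x ↦ a → y ↦ b → a ≡ b → (x ∷ y ∷ []) eq.↦ 1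
    eq-≢ : ∀ {x y a b} → x ↦ a → y ↦ b → a ≢ b → (x ∷ y ∷ []) eq.↦ 0

record Operation (E : Set) : Set where
  constructor operation
  field
    arity : ℕ
    apply : Vec E arity → E

record Structure : Set₁ where
  constructor ⟨_,_⟩
  field
    Carrier    : Set
    operations : List (Operation Carrier)

record ComputableRelativeTo {E : Set} (i : ℕ ⇀ E) (op : Operation E) : Set where
  open _⇀_ i using (_↦_)
  open Operation op
  field
    tracker : ComputableFun (dom i ^ arity) (dom i)

  module tracker = ComputableFun tracker

  field
    tracks : ∀ {xs es y} → Pointwise _↦_ xs es → xs tracker.↦ y → y ↦ apply es

record IsAdmissibleIndexing (𝓔 : Structure) (i : ℕ ⇀ Structure.Carrier 𝓔) : Set where
  open Structure 𝓔
  field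
    isIndexing : IsIndexing i
    computable : ∀ {op} → op ∈ operations → ComputableRelativeTo i op

record ComputabilityStable (𝓔 : Structure) : Set₁ where
  open Structure 𝓔
  field
    admissible : ∃ (IsAdmissibleIndexing 𝓔)
    -- j′ = j ∘ h as partial functions on ℕ, so j ∘ h is undefined off dom j′;
    -- h can always be cut down to the enumerable set dom j′.
    unique     : ∀ {j j′ : ℕ ⇀ Carrier} →
                 IsAdmissibleIndexing 𝓔 j → IsAdmissibleIndexing 𝓔 j′ →
                 Σ (ComputableFun (dom j′ ^ 1) (dom j)) λ h →
                   j′ ≗ₚ j ∘ₚ unary (partialFun h)

successor : Operation ℕ
successor = operation 1 λ { (x ∷ []) → suc x }

addition : Operation ℕ
addition = operation 2 λ { (x ∷ y ∷ []) → x + y }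

⟨ℕ,S⟩ : Structure
⟨ℕ,S⟩ = ⟨ ℕ , [ successor ] ⟩

⟨ℕ,+⟩ : Structure
⟨ℕ,+⟩ = ⟨ ℕ , [ addition ] ⟩

{-# OPTIONS --safe #-}
-- In an admissible indexing j of ⟨ℕ,S⟩, iterating the tracker of S from an index
-- of 0 computes a map `numeral` sending n to an index of n.  Given two such
-- indexings j and j′, an index x ∈ dom j′ is decoded by searching, with the
-- computable equality of j′, for the least n such that x and numeral′ n are
-- equal; then numeral n is the translation of x.  A further search
-- for x in the enumeration of dom j′ makes the translation diverge off dom j′.
-- Adding a fixed index of 1 turns an admissible indexing of ⟨ℕ,+⟩ into one of ⟨ℕ,S⟩.
module Submission where

open import Data.Fin.Patterns using (0F; 1F)
open import Data.List.Relation.Unary.Any using (here)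
open import Data.Nat.Base using (ℕ; zero; suc; pred; _+_; _∸_; _<_)
open import Data.Nat.Properties using (<⇒≢; ≤-antisym; 0∸n≡0; m+n≡0⇒m≡0; m+n≡0⇒n≡0; m<1+n⇒m<n∨m≡n; m∸n≡0⇒m≤n; m≤n⇒m∸n≡0; n≢0⇒n>0; n∸n≡0; pred[m∸n]≡m∸[1+n])
open import Data.Product.Base using (Σ; ∃; _×_; _,_; proj₁; proj₂; ∃-syntax)
open import Data.Sum.Base using (_⊎_; inj₁; inj₂)
open import Data.Unit.Base using (tt)
open import Data.Vec.Base using ([]; _∷_)
open import Data.Vec.Relation.Binary.Pointwise.Inductive using ([]; _∷_)
open import Data.Vec.Relation.Unary.All using ([]; _∷_)
open import Function.Bundles using (_⇔_; mk⇔; module Equivalence)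
open import Level using (0ℓ)
open import Relation.Binary.PropositionalEquality using (_≡_; _≢_; refl; subst; cong₂; ≢-sym)
open import Relation.Nullary.Negation using (contradiction)
open import Relation.Unary using (Pred)
open import Defs

-- Codes for elementary arithmetic

constᶜ : ∀ {n} → ℕ → PR n
constᶜ zero    = zer
constᶜ (suc k) = comp suc (constᶜ k ∷ [])

constᶜ-⇓ : ∀ {n xs} k → constᶜ {n} k ⟨ xs ⟩⇓ k
constᶜ-⇓ zero    = zer⇓
constᶜ-⇓ (suc k) = comp⇓ (constᶜ-⇓ k ∷ []) suc⇓

predᶜ : PR 1
predᶜ = rec zer (proj 0F)

predᶜ-⇓ : ∀ n → predᶜ ⟨ n ∷ [] ⟩⇓ pred n
predᶜ-⇓ zero    = rec⇓-z zer⇓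
predᶜ-⇓ (suc n) = rec⇓-s (predᶜ-⇓ n) proj⇓

isZeroᶜ : PR 1
isZeroᶜ = rec (constᶜ 1) zer

isZeroᶜ-⇓ : ∀ n → isZeroᶜ ⟨ n ∷ [] ⟩⇓ 1 ∸ n
isZeroᶜ-⇓ zero          = rec⇓-z (constᶜ-⇓ 1)
-- The expected value is now `0 ∸ n`, which reduces only once `n` is split.
isZeroᶜ-⇓ (suc zero)    = rec⇓-s (isZeroᶜ-⇓ zero) zer⇓
isZeroᶜ-⇓ (suc (suc n)) = rec⇓-s (isZeroᶜ-⇓ (suc n)) zer⇓

addᶜ : PR 2
addᶜ = rec (proj 0F) (comp suc (proj 1F ∷ []))

addᶜ-⇓ : ∀ m n → addᶜ ⟨ m ∷ n ∷ [] ⟩⇓ m + n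
addᶜ-⇓ zero    n = rec⇓-z proj⇓
addᶜ-⇓ (suc m) n = rec⇓-s (addᶜ-⇓ m n) (comp⇓ (proj⇓ ∷ []) suc⇓)

-- The subtrahend comes first, since rec recurses on its first argument.
monusᶜ : PR 2
monusᶜ = rec (proj 0F) (comp predᶜ (proj 1F ∷ []))

monusᶜ-⇓ : ∀ m n → monusᶜ ⟨ m ∷ n ∷ [] ⟩⇓ n ∸ m
monusᶜ-⇓ zero    n = rec⇓-z proj⇓
monusᶜ-⇓ (suc m) n = subst (monusᶜ ⟨ suc m ∷ n ∷ [] ⟩⇓_) (pred[m∸n]≡m∸[1+n] n m)
  (rec⇓-s (monusᶜ-⇓ m n) (comp⇓ (proj⇓ ∷ []) (predᶜ-⇓ (n ∸ m))))

-- The absolute difference: of the two truncated differences at least one is 0. It turns equality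
-- into a zero that `mu` can search for.
dist : ℕ → ℕ → ℕ
dist m n = (n ∸ m) + (m ∸ n)

dist-refl : ∀ n → dist n n ≡ 0
dist-refl n = cong₂ _+_ (n∸n≡0 n) (n∸n≡0 n)

dist≡0⇒≡ : ∀ {m n} → dist m n ≡ 0 → m ≡ n
dist≡0⇒≡ {m} {n} d≡0 = ≤-antisym
  (m∸n≡0⇒m≤n (m+n≡0⇒n≡0 (n ∸ m) d≡0))
  (m∸n≡0⇒m≤n (m+n≡0⇒m≡0 (n ∸ m) d≡0))

distᶜ : PR 2
distᶜ = comp addᶜ (monusᶜ ∷ comp monusᶜ (proj 1F ∷ proj 0F ∷ []) ∷ [])

distᶜ-⇓ : ∀ m n → distᶜ ⟨ m ∷ n ∷ [] ⟩⇓ dist m n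
distᶜ-⇓ m n = comp⇓
  (monusᶜ-⇓ m n ∷ comp⇓ (proj⇓ ∷ proj⇓ ∷ []) (monusᶜ-⇓ n m) ∷ [])
  (addᶜ-⇓ (n ∸ m) (m ∸ n))

-- Unbounded search and semidecidability

-- Induction on `k`: once all values below `k` are nonzero, the value at `k` either ends the search
-- or prolongs the nonzero stretch. Thus any zero, not only the first, makes `mu` halt.
mu-search : ∀ {n} {c : PR (suc n)} {xs} → (∀ k → ∃[ y ] c ⟨ k ∷ xs ⟩⇓ y) →
            ∀ k → (∃[ l ] mu c ⟨ xs ⟩⇓ l) ⊎ (∀ z → z < k → ∃[ v ] c ⟨ z ∷ xs ⟩⇓ suc v)
mu-search total zero = inj₂ λ _ ()
mu-search {c = c} {xs} total (suc k) with mu-search total k | total k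
... | inj₁ found   | _         = inj₁ found
... | inj₂ nonzero | zero , p  = inj₁ (k , mu⇓ p nonzero)
... | inj₂ nonzero | suc v , p = inj₂ extended
  where
  extended : ∀ z → z < suc k → ∃[ v ] c ⟨ z ∷ xs ⟩⇓ suc v
  extended z z<1+k with m<1+n⇒m<n∨m≡n z<1+k
  ... | inj₁ z<k  = nonzero z z<k
  ... | inj₂ refl = v , p

mu-defined : ∀ {n} {c : PR (suc n)} {xs k} → (∀ k → ∃[ y ] c ⟨ k ∷ xs ⟩⇓ y) →
             c ⟨ k ∷ xs ⟩⇓ 0 → ∃[ l ] mu c ⟨ xs ⟩⇓ l
mu-defined {k = k} total p with mu-search total k
... | inj₁ found   = found
... | inj₂ nonzero = k , mu⇓ p nonzero

enumerable⇒semidecidable : ∀ {A : Pred ℕ 0ℓ} → ∃ A → EffectivelyEnumerable A →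
                           Σ (PR 1) λ c → ∀ x → A x ⇔ dom (unary ⟦ c ⟧) x
enumerable⇒semidecidable (x , Ax) (inj₁ empty) = contradiction Ax (empty x)
enumerable⇒semidecidable {A} _ (inj₂ (f , enumerates)) = mu search , λ x → mk⇔ (halts x) (halts⇒∈ x)
  where
  module f = ComputableFun f

  search : PR 2
  search = comp distᶜ (comp f.code (proj 0F ∷ []) ∷ proj 1F ∷ [])

  search-⇓ : ∀ {x y k} → f.code ⟨ k ∷ [] ⟩⇓ y → search ⟨ k ∷ x ∷ [] ⟩⇓ dist y x
  search-⇓ {x} {y} p = comp⇓ (comp⇓ (proj⇓ ∷ []) p ∷ proj⇓ ∷ []) (distᶜ-⇓ y x)

  search-total : ∀ x k → ∃[ y ] search ⟨ k ∷ x ∷ [] ⟩⇓ y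
  search-total x k with (_ , _ , p) ← f.maps {k ∷ []} (tt ∷ []) = _ , search-⇓ p

  halts : ∀ x → A x → dom (unary ⟦ mu search ⟧) x
  halts x Ax with (k , p) ← Equivalence.to (enumerates x) Ax =
    mu-defined (search-total x) (subst (search ⟨ k ∷ x ∷ [] ⟩⇓_) (dist-refl x) (search-⇓ p))

  halts⇒∈ : ∀ x → dom (unary ⟦ mu search ⟧) x → A x
  halts⇒∈ x (k , mu⇓ q _)
    -- The number at which `mu` stops is a position where the enumeration takes the value `x`.
    with (y , _ , p) ← f.maps {k ∷ []} (tt ∷ [])
    with refl ← dist≡0⇒≡ {y} {x} (⇓-functional (search-⇓ p) q) =
    Equivalence.from (enumerates x) (k , p)

-- Numerals and decoding in one indexing

module Numerals {j : ℕ ⇀ ℕ} (j-admissible : IsAdmissibleIndexing ⟨ℕ,S⟩ j) where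
  open IsAdmissibleIndexing j-admissible public
  open IsIndexing isIndexing public
  open _⇀_ j public using (_↦_; functional)
  open ComputableRelativeTo (computable (here refl)) public

  numeral : PR 1
  numeral = rec (constᶜ (proj₁ (surjective 0))) (comp tracker.code (proj 1F ∷ []))

  numeral-⇓ : ∀ n → ∃[ x ] x ↦ n × numeral ⟨ n ∷ [] ⟩⇓ x
  numeral-⇓ zero with (x , x↦0) ← surjective 0 = x , x↦0 , rec⇓-z (constᶜ-⇓ x)
  numeral-⇓ (suc n)
    with (x , x↦n , p) ← numeral-⇓ n
    with (y , _ , q) ← tracker.maps ((n , x↦n) ∷ []) =
    y , tracks (x↦n ∷ []) q , rec⇓-s p (comp⇓ (proj⇓ ∷ []) q)

  decode-test : PR 2
  -- `eq` answers 1 on equality whereas `mu` looks for 0, so the answer is flipped.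
  decode-test = comp isZeroᶜ (comp eq.code (proj 1F ∷ comp numeral (proj 0F ∷ []) ∷ []) ∷ [])

  decode : PR 1
  decode = mu decode-test

  decode-⇓ : ∀ {x n} → x ↦ n → decode ⟨ x ∷ [] ⟩⇓ n
  decode-⇓ {x} {n} x↦n = mu⇓ hit λ k k<n → 0 , miss k (<⇒≢ k<n)
    where
    hit : decode-test ⟨ n ∷ x ∷ [] ⟩⇓ 0
    hit with (y , y↦n , p) ← numeral-⇓ n =
      comp⇓ (comp⇓ (proj⇓ ∷ comp⇓ (proj⇓ ∷ []) p ∷ []) (eq-≡ x↦n y↦n refl) ∷ []) (isZeroᶜ-⇓ 1)

    miss : ∀ k → k ≢ n → decode-test ⟨ k ∷ x ∷ [] ⟩⇓ 1
    miss k k≢n with (y , y↦k , p) ← numeral-⇓ k =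
      comp⇓ (comp⇓ (proj⇓ ∷ comp⇓ (proj⇓ ∷ []) p ∷ []) (eq-≢ x↦n y↦k (≢-sym k≢n)) ∷ []) (isZeroᶜ-⇓ 0)

-- Translation between two indexings

translation : ∀ {j j′ : ℕ ⇀ ℕ} →
              IsAdmissibleIndexing ⟨ℕ,S⟩ j → IsAdmissibleIndexing ⟨ℕ,S⟩ j′ →
              Σ (ComputableFun (dom j′ ^ 1) (dom j)) λ h → j′ ≗ₚ j ∘ₚ unary (partialFun h)
translation {j} {j′} adm adm′ =
  record { code = code ; maps = λ { ((n , x↦n) ∷ []) → let y , p , y↦n = code-⇓ x↦n in y , (n , y↦n) , p } } ,
  λ x n → mk⇔ code-⇓ (code-⇓⁻¹ x n)
  where
  module J  = Numerals adm
  module J′ = Numerals adm′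

  semidecision : Σ (PR 1) λ c → ∀ x → dom j′ x ⇔ dom (unary ⟦ c ⟧) x
  semidecision with (x , x↦0) ← J′.surjective 0 =
    enumerable⇒semidecidable (x , 0 , x↦0) J′.dom-enumerable

  guard : PR 1
  guard = proj₁ semidecision

  -- comp is strict, so the code diverges wherever the discarded guard does.
  code : PR 1
  code = comp (proj 1F) (guard ∷ comp J.numeral (J′.decode ∷ []) ∷ [])

  code-⇓ : ∀ {x n} → x J′.↦ n → ∃[ y ] code ⟨ x ∷ [] ⟩⇓ y × y J.↦ n
  code-⇓ {x} {n} x↦n
    with (_ , g) ← Equivalence.to (proj₂ semidecision x) (n , x↦n)
    with (y , y↦n , p) ← J.numeral-⇓ n =
    y , comp⇓ (g ∷ comp⇓ (J′.decode-⇓ x↦n ∷ []) p ∷ []) proj⇓ , y↦n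

  -- The halting guard puts `x` in `dom j′`, with some value `m`. The forward direction then gives
  -- an output indexing `m`, and functionality of evaluation and of `j` forces `m` to be `n`.
  code-⇓⁻¹ : ∀ x n → ∃[ y ] code ⟨ x ∷ [] ⟩⇓ y × y J.↦ n → x J′.↦ n
  code-⇓⁻¹ x n (y , p@(comp⇓ (g ∷ _) _) , y↦n)
    with (m , x↦m) ← Equivalence.from (proj₂ semidecision x) (_ , g)
    with (y′ , p′ , y′↦m) ← code-⇓ x↦m
    with refl ← ⇓-functional p p′
    with refl ← J.functional y↦n y′↦m = x↦m

-- The identity as an admissible indexing

identityIndexing : ℕ ⇀ ℕ
identityIndexing = record { _↦_ = _≡_ ; functional = λ { refl refl → refl } }

identity-isIndexing : IsIndexing identityIndexing
identity-isIndexing = record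
  { dom-enumerable = inj₂
      ( record { code = proj 0F ; maps = λ { {x ∷ []} _ → x , tt , proj⇓ } }
      , λ x → mk⇔ (λ _ → x , proj⇓) (λ _ → x , refl) )
  ; surjective     = λ n → n , refl
  ; eq             = record { code = eqᶜ ; maps = λ { {x ∷ y ∷ []} _ → _ , 0∨1 (dist x y) , eqᶜ-⇓ x y } }
  ; eq-≡           = λ { {x} refl refl refl → subst (λ d → eqᶜ ⟨ x ∷ x ∷ [] ⟩⇓ 1 ∸ d) (dist-refl x) (eqᶜ-⇓ x x) }
  ; eq-≢           = λ { {x} {y} refl refl x≢y → eqᶜ-⇓-≢ x y x≢y }
  }
  where
  eqᶜ : PR 2
  eqᶜ = comp isZeroᶜ (distᶜ ∷ [])

  eqᶜ-⇓ : ∀ x y → eqᶜ ⟨ x ∷ y ∷ [] ⟩⇓ 1 ∸ dist x y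
  eqᶜ-⇓ x y = comp⇓ (distᶜ-⇓ x y ∷ []) (isZeroᶜ-⇓ (dist x y))

  0∨1 : ∀ d → 1 ∸ d ≡ 0 ⊎ 1 ∸ d ≡ 1
  0∨1 zero    = inj₂ refl
  0∨1 (suc d) = inj₁ (0∸n≡0 d)

  eqᶜ-⇓-≢ : ∀ x y → x ≢ y → eqᶜ ⟨ x ∷ y ∷ [] ⟩⇓ 0
  eqᶜ-⇓-≢ x y x≢y = subst (eqᶜ ⟨ x ∷ y ∷ [] ⟩⇓_) (m≤n⇒m∸n≡0 (n≢0⇒n>0 λ d≡0 → x≢y (dist≡0⇒≡ d≡0))) (eqᶜ-⇓ x y)

identity-admissible-S : IsAdmissibleIndexing ⟨ℕ,S⟩ identityIndexing
identity-admissible-S = record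
  { isIndexing = identity-isIndexing
  ; computable = λ { (here refl) → record
      { tracker = record { code = suc ; maps = λ { {x ∷ []} _ → suc x , (suc x , refl) , suc⇓ } }
      ; tracks  = λ { (refl ∷ []) suc⇓ → refl }
      } }
  }

identity-admissible-+ : IsAdmissibleIndexing ⟨ℕ,+⟩ identityIndexing
identity-admissible-+ = record
  { isIndexing = identity-isIndexing
  ; computable = λ { (here refl) → record
      { tracker = record { code = addᶜ ; maps = λ { {x ∷ y ∷ []} _ → x + y , (x + y , refl) , addᶜ-⇓ x y } }
      ; tracks  = λ { {x ∷ y ∷ []} (refl ∷ refl ∷ []) p → ⇓-functional p (addᶜ-⇓ x y) }
      } }
  }

-- From addition to successor

+-admissible⇒S-admissible : ∀ {j} → IsAdmissibleIndexing ⟨ℕ,+⟩ j → IsAdmissibleIndexing ⟨ℕ,S⟩ j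
+-admissible⇒S-admissible {j} adm = record
  { isIndexing = isIndexing
  ; computable = λ { (here refl) → record
      { tracker = record { code = sucᶜ ; maps = λ { (x∈ ∷ []) → sucᶜ-maps x∈ } }
      ; tracks  = λ { (x↦n ∷ []) p → sucᶜ-tracks x↦n p }
      } }
  }
  where
  open IsAdmissibleIndexing adm
  open IsIndexing isIndexing using (surjective)
  open ComputableRelativeTo (computable (here refl))
  open _⇀_ j using (_↦_)

  one : ℕ
  one = proj₁ (surjective 1)

  one↦1 : one ↦ 1
  one↦1 = proj₂ (surjective 1)

  sucᶜ : PR 1
  -- With `one` as the first summand, `tracks` yields `1 + n`, which is `suc n` by computation.
  sucᶜ = comp tracker.code (constᶜ one ∷ proj 0F ∷ [])

  sucᶜ-maps : ∀ {x} → dom j x → ∃[ y ] dom j y × sucᶜ ⟨ x ∷ [] ⟩⇓ y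
  sucᶜ-maps x∈ with (y , y∈ , p) ← tracker.maps ((1 , one↦1) ∷ x∈ ∷ []) =
    y , y∈ , comp⇓ (constᶜ-⇓ one ∷ proj⇓ ∷ []) p

  sucᶜ-tracks : ∀ {x n y} → x ↦ n → sucᶜ ⟨ x ∷ [] ⟩⇓ y → y ↦ suc n
  sucᶜ-tracks x↦n (comp⇓ (c ∷ proj⇓ ∷ []) p)
    with refl ← ⇓-functional c (constᶜ-⇓ one) = tracks (one↦1 ∷ x↦n ∷ []) p

proposition4 : ComputabilityStable ⟨ℕ,S⟩ × ComputabilityStable ⟨ℕ,+⟩
proposition4 =
  record
    { admissible = identityIndexing , identity-admissible-S
    ; unique     = translation
    } ,
  record
    { admissible = identityIndexing , identity-admissible-+
    -- The required `h` depends on `j` and `j′` only as partial functions, so the translation for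
    -- the successor serves unchanged.
    ; unique     = λ adm adm′ →
        translation (+-admissible⇒S-admissible adm) (+-admissible⇒S-admissible adm′)
    }
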